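{- Under automatic service, there need not exist an optimal schedule whose batches are consecutive blocks of arrival epochs; that is, there exist a finite metric space, an initial server position and a finite input for which no optimal automatic-service schedule has all its nonempty service batches equal to consecutive blocks of complete arrival epochs.
   Context: Model. $(X,d)$ is a finite metric space with initial server position $s_0\in X$. An input is a finite set of request occurrences; each request $q$ has an arrival time $a(q)\ge 0$ and a location $x(q)\in X$. The distinct arrival times are $a_1<\cdots<a_m$, and the epoch $R_h$ is the nonempty set of requests arriving at $a_h$. A consecutive block of complete arrival epochs is a set $R_p\cup R_{p+1}\cup\cdots\cup R_j$ with $1\le p\le j\le m$. A walk $P=(v_0,\ldots,v_\ell)$ in $X$ ($\ell\ge 0$) is executed instantaneously at one time, visits its listed vertices, and has length $\operatorname{len}(P)=\sum_i d(v_{i-1},v_i)$. A schedule is a finite sequence of atomic actions with nondecreasing timestamps. At time $t$ the complete epoch arriving at $t$ is processed first; then one action at $t$ performs a finite ordered sequence of walks (components), and no further arrival is processed until the action ends. The first walk starts at $s_0$ and every later one starts where its predecessor ended; the server stays put between actions. A component walk $P$ at time $t$ during which a nonempty set $B$ of pending requests is served is one service event with batch $B$ and cost $\operatorname{len}(P)+\max_{q\in B}(t-a(q))$; a component serving no request costs $\operatorname{len}(P)$. The cost of a schedule is the sum of these costs; every request must eventually be served. Automatic service: every pending request whose location is visited by a walk is served in that event (so a nominally pure movement becomes a service event if it visits a pending request), and a request arriving at the current server position is served immediately (zero movement and zero delay). A schedule is optimal if its cost equals the infimum over feasible automatic-service schedules. Batches are considered in chronological order of service, blocks following one another in arrival order.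 -}

module Defs where

open import Algebra.Bundles using (CommutativeRing)
open import Algebra.Structures using (IsCommutativeRing)
open import Data.Fin.Base as Fin using (Fin)
open import Data.Fin.Properties as Fin using ()
open import Data.Fin.Subset using (Subset; _∈_; _∪_; _∩_; _─_; Nonempty) renaming (⊥ to ∅)
open import Data.Fin.Subset.Properties using (_∈?_)
open import Data.List.Base using (List; []; _∷_; map; concatMap; foldr; merge; allFin; filter)
import Data.List.Extrema as Extrema
import Data.List.Membership.DecPropositional as DecMembership
open import Data.List.NonEmpty.Base as List⁺ using (List⁺; _∷_; toList)
open import Data.List.Relation.Unary.All using (All)
open import Data.List.Relation.Unary.Any using (Any)
open import Data.List.Relation.Unary.Linked using (Linked)
open import Data.Nat.Base using (ℕ)
open import Data.Product.Base using (∃₂; ∃-syntax; _×_; _,_)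
open import Data.Unit.Base using (⊤)
open import Data.Vec.Base using (tabulate)
open import Function.Bundles using (_⇔_)
open import Function.Metric.Structures using (IsGeneralMetric)
open import Level using (Level; suc; _⊔_)
open import Relation.Binary.Bundles using (DecTotalOrder)
open import Relation.Binary.Core using (Rel)
import Relation.Binary.Construct.NonStrictToStrict as NonStrictToStrict
open import Relation.Binary.PropositionalEquality.Core using (_≡_)
open import Relation.Binary.Structures using (IsDecTotalOrder)
open import Relation.Nullary using (¬_)
open import Relation.Nullary.Decidable using (does)

-- Times, distances and costs are taken in an arbitrary linearly ordered field;
-- the real numbers (read classically) and the rationals are instances.
record OrderedField (c ℓ₁ ℓ₂ : Level) : Set (suc (c ⊔ ℓ₁ ⊔ ℓ₂)) where
  infix  8 -_
  infixl 7 _*_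
  infixl 6 _+_
  infix  4 _≈_ _≤_
  field
    Carrier           : Set c
    _≈_               : Rel Carrier ℓ₁
    _≤_               : Rel Carrier ℓ₂
    _+_ _*_           : Carrier → Carrier → Carrier
    -_                : Carrier → Carrier
    0# 1#             : Carrier
    isCommutativeRing : IsCommutativeRing _≈_ _+_ _*_ -_ 0# 1#
    0≉1               : ¬ (0# ≈ 1#)
    inverse           : ∀ x → ¬ (x ≈ 0#) → ∃[ y ] (x * y ≈ 1#)
    isDecTotalOrder   : IsDecTotalOrder _≈_ _≤_
    +-monoˡ-≤         : ∀ {x y} z → x ≤ y → (x + z) ≤ (y + z)
    *-nonneg          : ∀ {x y} → 0# ≤ x → 0# ≤ y → 0# ≤ (x * y)

  commutativeRing : CommutativeRing c ℓ₁
  commutativeRing = record { isCommutativeRing = isCommutativeRing }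

  decTotalOrder : DecTotalOrder c ℓ₁ ℓ₂
  decTotalOrder = record { isDecTotalOrder = isDecTotalOrder }

  open CommutativeRing commutativeRing public using (_-_)
  open DecTotalOrder decTotalOrder public using (_≟_; _≤?_; totalOrder)
  open NonStrictToStrict _≈_ _≤_ public using (_<_)

  IsInfimum : ∀ {p} → (Carrier → Set p) → Carrier → Set (c ⊔ ℓ₂ ⊔ p)
  IsInfimum P i = (∀ x → P x → i ≤ x) × (∀ l → (∀ x → P x → l ≤ x) → l ≤ i)

record FiniteMetricSpace {c ℓ₁ ℓ₂} (K : OrderedField c ℓ₁ ℓ₂) : Set (c ⊔ ℓ₁ ⊔ ℓ₂) where
  open OrderedField K
  field
    size     : ℕ
    d        : Fin size → Fin size → Carrier
    isMetric : IsGeneralMetric _≡_ _≈_ _≤_ 0# _+_ d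

  Point : Set
  Point = Fin size

-- `time` enumerates the distinct arrival times in increasing order; the last
-- three fields determine it (and `numEpochs`) from the arrival times.
record Input {c ℓ₁ ℓ₂} (K : OrderedField c ℓ₁ ℓ₂) (X : FiniteMetricSpace K)
             : Set (c ⊔ ℓ₁ ⊔ ℓ₂) where
  open OrderedField K
  open FiniteMetricSpace X
  field
    numRequests : ℕ
    arrival     : Fin numRequests → Carrier
    arrival≥0   : ∀ q → 0# ≤ arrival q
    location    : Fin numRequests → Point
    numEpochs   : ℕ
    time        : Fin numEpochs → Carrier
    time-mono   : ∀ {h i} → h Fin.< i → time h < time i
    arrivalTime : ∀ q → ∃[ h ] (arrival q ≈ time h)
    nonempty    : ∀ h → ∃[ q ] (arrival q ≈ time h)

  Request : Set
  Request = Fin numRequests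

  epoch : Fin numEpochs → Subset numRequests
  epoch h = tabulate (λ q → does (arrival q ≟ time h))

module _ {c ℓ₁ ℓ₂} (K : OrderedField c ℓ₁ ℓ₂) (X : FiniteMetricSpace K)
         (s₀ : FiniteMetricSpace.Point X) (I : Input K X) where

  open OrderedField K
  open FiniteMetricSpace X
  open Input I
  open DecMembership (Fin._≟_ {size}) using () renaming (_∈?_ to _∈ₗ?_)

  Walk : Set
  Walk = List⁺ Point

  length : Walk → Carrier
  length (v ∷ vs) = go v vs
    where
    go : Point → List Point → Carrier
    go v []       = 0#
    go v (w ∷ ws) = d v w + go w ws

  record Action : Set c where
    field
      timestamp  : Carrier
      components : List Walk
  open Action

  Schedule : Set c
  Schedule = List Action

  Connected : Point → List Walk → Set
  Connected s []       = ⊤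
  Connected s (P ∷ Ps) = List⁺.head P ≡ s × Connected (List⁺.last P) Ps

  record Event : Set c where
    constructor event
    field
      when  : Carrier
      walk  : Walk
      batch : Subset numRequests
  open Event

  maxDelay : Carrier → Subset numRequests → Carrier
  maxDelay t B with map (λ q → t - arrival q) (filter (_∈? B) (allFin numRequests))
  ... | []     = 0#
  ... | x ∷ xs = Extrema.max totalOrder x xs

  -- An event with empty batch is a pure movement and costs only its length.
  eventCost : Event → Carrier
  eventCost (event t P B) = length P + maxDelay t B

  data Step : Set c where
    arrive  : Fin numEpochs → Step
    perform : Carrier → Walk → Step

  stepTime : Step → Carrier
  stepTime (arrive h)    = time h
  stepTime (perform t _) = t

  -- `merge` is left-biased, so an epoch arriving at t precedes the action at t.
  timeline : Schedule → List Step
  timeline S = merge (λ s s′ → stepTime s ≤? stepTime s′)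
    (map arrive (allFin numEpochs))
    (concatMap (λ A → map (perform (timestamp A)) (components A)) S)

  visited : Walk → Subset numRequests
  visited P = tabulate (λ q → does (location q ∈ₗ? toList P))

  -- Automatic service.  The arguments of `run` are the current server position
  -- and the set of pending requests.  On arrival of an epoch, the trivial walk
  -- at the current position serves the requests arriving there, as an event of
  -- zero length and zero delay preceding any action at that time.
  run : Point → Subset numRequests → List Step → List Event
  run v Q []                 = []
  run v Q (arrive h ∷ ss)    =
    event (time h) (v ∷ []) ((Q ∪ epoch h) ∩ visited (v ∷ []))
      ∷ run v ((Q ∪ epoch h) ─ visited (v ∷ [])) ss
  run v Q (perform t P ∷ ss) =
    event t P (Q ∩ visited P) ∷ run (List⁺.last P) (Q ─ visited P) ss

  events : Schedule → List Event
  events S = run s₀ ∅ (timeline S)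

  cost : Schedule → Carrier
  cost S = foldr (λ e x → eventCost e + x) 0# (events S)

  -- Time starts at 0.
  record Feasible (S : Schedule) : Set (c ⊔ ℓ₂) where
    field
      nonnegative   : All (λ A → 0# ≤ timestamp A) S
      nondecreasing : Linked (λ A B → timestamp A ≤ timestamp B) S
      connected     : Connected s₀ (concatMap components S)
      allServed     : ∀ (q : Request) → Any (λ e → q ∈ batch e) (events S)

  FeasibleCost : Carrier → Set (c ⊔ ℓ₁ ⊔ ℓ₂)
  FeasibleCost x = ∃[ S ] (Feasible S × x ≈ cost S)

  Optimal : Schedule → Set (c ⊔ ℓ₁ ⊔ ℓ₂)
  Optimal S = Feasible S × IsInfimum FeasibleCost (cost S)

  IsBlock : Subset numRequests → Set
  IsBlock B = ∃₂ λ (p j : Fin numEpochs) → p Fin.≤ j ×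
    (∀ (q : Request) → q ∈ B ⇔ (∃[ h ] (p Fin.≤ h × h Fin.≤ j × q ∈ epoch h)))

  -- The blocks are not required to be served in arrival order, so failure of
  -- this property also excludes the ordered variant.
  AllBatchesBlocks : Schedule → Set c
  AllBatchesBlocks S = All (λ e → Nonempty (batch e) → IsBlock (batch e)) (events S)

{-# OPTIONS --safe #-}
-- Two requests arrive together at time 0, one at the initial server position
-- and one elsewhere.  Automatic service serves the first on arrival, before
-- the server can move, so the batch of that event is a proper part of the only
-- epoch, whatever the schedule does afterwards.
module Submission where

open import Defs
open import Algebra.Bundles using (CommutativeRing)
import Algebra.Properties.Ring as RingProperties
open import Data.Fin.Base using (Fin; zero; suc)
import Data.Fin.Properties as Fin
open import Data.Fin.Subset using (Subset; _∈_; _∉_; _∪_; _∩_) renaming (⊥ to ∅)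
open import Data.Fin.Subset.Properties using (p∩q⊆q; x∈p∩q⁺; q⊆p∪q)
open import Data.List.Base using ([]; _∷_; merge)
open import Data.List.NonEmpty.Base using (_∷_)
open import Data.List.Relation.Unary.All as All using (All; []; _∷_)
import Data.List.Relation.Unary.All.Properties as All
open import Data.Nat.Base using (ℕ)
open import Data.Product.Base using (∃-syntax; _×_; _,_)
open import Data.Sum.Base using (inj₁; inj₂)
open import Data.Vec.Base using (there)
open import Data.Vec.Properties using (lookup⇒[]=; lookup∘tabulate)
open import Function.Base using (_$_)
open import Function.Bundles using (Equivalence)
open import Function.Metric.Structures using (IsGeneralMetric)
open import Relation.Binary.Bundles using (DecTotalOrder)
open import Relation.Binary.Core using (Rel)
open import Relation.Binary.Definitions using (Decidable)
import Relation.Binary.Reasoning.PartialOrder as ≤-Reasoning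
open import Relation.Binary.PropositionalEquality as ≡ using (_≡_; refl)
open import Relation.Nullary using (¬_; yes; no; contradiction)
open import Relation.Nullary.Decidable using (dec-true)

-- `merge` compares the two heads and keeps the left one when `R` holds. Applied to timelines, this
-- puts the first arrival ahead of every action.
merge-head : ∀ {a r} {A : Set a} {R : Rel A r} (R? : Decidable R) {x xs ys} →
             All (R x) ys → ∃[ zs ] (merge R? (x ∷ xs) ys ≡ x ∷ zs)
merge-head R? [] = _ , refl
merge-head R? {x} {ys = y ∷ _} (Rxy ∷ _) rewrite dec-true (R? x y) Rxy = _ , refl

module _ {c ℓ₁ ℓ₂} (K : OrderedField c ℓ₁ ℓ₂) where

  open OrderedField K
  open CommutativeRing commutativeRing
    using (ring; +-comm; +-identityˡ; -‿inverseʳ)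
    renaming (refl to ≈-refl; sym to ≈-sym)
  open RingProperties ring using (-1*x≈-x; -‿involutive)
  open DecTotalOrder decTotalOrder
    using (isPartialOrder; poset; total; reflexive)
    renaming (refl to ≤-refl; trans to ≤-trans)
  open ≤-Reasoning poset

  -- Totality leaves the case `1# ≤ 0#`; there `- 1#` is nonnegative, and `1#` is its square.
  0≤1 : 0# ≤ 1#
  0≤1 with total 0# 1#
  ... | inj₁ 0≤1 = 0≤1
  ... | inj₂ 1≤0 = begin
    0#            ≤⟨ *-nonneg 0≤-1 0≤-1 ⟩
    - 1# * - 1#   ≈⟨ -1*x≈-x (- 1#) ⟩
    - (- 1#)      ≈⟨ -‿involutive 1# ⟩
    1#            ∎
    where
    0≤-1 : 0# ≤ - 1#
    0≤-1 = begin
      0#          ≈⟨ -‿inverseʳ 1# ⟨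
      1# + - 1#   ≤⟨ +-monoˡ-≤ (- 1#) 1≤0 ⟩
      0# + - 1#   ≈⟨ +-identityˡ (- 1#) ⟩
      - 1#        ∎

  x≤x+y : ∀ {x y} → 0# ≤ y → x ≤ x + y
  x≤x+y {x} {y} 0≤y = begin
    x        ≈⟨ +-identityˡ x ⟨
    0# + x   ≤⟨ +-monoˡ-≤ x 0≤y ⟩
    y + x    ≈⟨ +-comm y x ⟩
    x + y    ∎

  module _ {n : ℕ} where

    discrete : Fin n → Fin n → Carrier
    discrete x y with x Fin.≟ y
    ... | yes _ = 0#
    ... | no  _ = 1#

    discrete-nonneg : ∀ x y → 0# ≤ discrete x y
    discrete-nonneg x y with x Fin.≟ y
    ... | yes _ = ≤-refl
    ... | no  _ = 0≤1

    discrete≤1 : ∀ x y → discrete x y ≤ 1#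
    discrete≤1 x y with x Fin.≟ y
    ... | yes _ = 0≤1
    ... | no  _ = ≤-refl

    ≡⇒discrete≈0 : ∀ {x y} → x ≡ y → discrete x y ≈ 0#
    ≡⇒discrete≈0 {x} {y} x≡y with x Fin.≟ y
    ... | yes _   = ≈-refl
    ... | no  x≢y = contradiction x≡y x≢y

    discrete≈0⇒≡ : ∀ {x y} → discrete x y ≈ 0# → x ≡ y
    discrete≈0⇒≡ {x} {y} d≈0 with x Fin.≟ y
    ... | yes x≡y = x≡y
    ... | no  _   = contradiction (≈-sym d≈0) 0≉1

    discrete-sym : ∀ x y → discrete x y ≈ discrete y x
    discrete-sym x y with x Fin.≟ y | y Fin.≟ x
    ... | yes _   | yes _   = ≈-refl
    ... | no  _   | no  _   = ≈-refl
    ... | yes x≡y | no  y≢x = contradiction (≡.sym x≡y) y≢x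
    ... | no  x≢y | yes y≡x = contradiction (≡.sym y≡x) x≢y

    -- Split on the first summand: if it is `0#`, the other two distances coincide; if it is `1#`,
    -- it already bounds every distance.
    discrete-triangle : ∀ x y z → discrete x z ≤ discrete x y + discrete y z
    discrete-triangle x y z with x Fin.≟ y
    ... | yes refl = reflexive (≈-sym (+-identityˡ _))
    ... | no  _    = ≤-trans (discrete≤1 x z) (x≤x+y (discrete-nonneg y z))

    discrete-isGeneralMetric : IsGeneralMetric _≡_ _≈_ _≤_ 0# _+_ discrete
    discrete-isGeneralMetric = record
      { isSemiMetric = record
        { isQuasiSemiMetric = record
          { isPreMetric = record
            { isProtoMetric = record
              { isPartialOrder  = isPartialOrder
              ; ≈-isEquivalence = ≡.isEquivalence
              ; cong            = λ { refl refl → ≈-refl }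
              ; nonNegative     = λ {x} {y} → discrete-nonneg x y
              }
            ; ≈⇒0 = ≡⇒discrete≈0
            }
          ; 0⇒≈ = discrete≈0⇒≡
          }
        ; sym = discrete-sym
        }
      ; triangle = discrete-triangle
      }

  discreteSpace : ℕ → FiniteMetricSpace K
  discreteSpace n = record
    { size     = n
    ; d        = discrete
    ; isMetric = discrete-isGeneralMetric
    }

  module _ {X : FiniteMetricSpace K} (I : Input K X) where
    open Input I

    -- Equality in an abstract field does not compute, so `dec-true` has to supply the value of the
    -- decision stored in `epoch h`.
    ∈-epoch : ∀ {q h} → arrival q ≈ time h → q ∈ epoch h
    ∈-epoch {q} {h} q≈h = lookup⇒[]= q (epoch h) $
      ≡.trans (lookup∘tabulate _ q) (dec-true (arrival q ≟ time h) q≈h)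

  simultaneousPair : Input K (discreteSpace 2)
  simultaneousPair = record
    { numRequests = 2
    ; arrival     = λ _ → 0#
    ; arrival≥0   = λ _ → ≤-refl
    -- With the server starting at `zero`, request `zero` lies under it and request `suc zero` away
    -- from it.
    ; location    = λ q → q
    ; numEpochs   = 1
    ; time        = λ _ → 0#
    ; time-mono   = λ { {zero} {zero} () }
    ; arrivalTime = λ _ → zero , ≈-refl
    ; nonempty    = λ _ → zero , ≈-refl
    }

  private
    I = simultaneousPair
  open Input I using (epoch; numRequests)

  -- Written exactly as `run` forms its first batch, from position `zero` with nothing pending, so
  -- that the two agree by definition.
  firstBatch : Subset numRequests
  firstBatch = (∅ ∪ epoch zero) ∩ visited K (discreteSpace 2) zero I (zero ∷ [])

  0∈firstBatch : zero ∈ firstBatch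
  0∈firstBatch = x∈p∩q⁺ (q⊆p∪q ∅ _ (∈-epoch I {h = zero} ≈-refl) , lookup⇒[]= zero _ refl)

  1∉firstBatch : suc zero ∉ firstBatch
  -- Points are concrete, so `visited` evaluates, and its entry at `suc zero` is false.
  1∉firstBatch 1∈ with p∩q⊆q (∅ ∪ epoch zero) _ 1∈
  ... | there ()

  -- A block contains all of its first epoch `p`, and request `suc zero` belongs to it since all
  -- arrivals and epoch times are `0#`.
  firstBatch-notBlock : ¬ IsBlock K (discreteSpace 2) zero I firstBatch
  firstBatch-notBlock (p , j , p≤j , ∈⇔) = 1∉firstBatch $
    Equivalence.from (∈⇔ (suc zero)) (p , Fin.≤-refl , p≤j , ∈-epoch I {h = p} ≈-refl)

  -- No action is timestamped before `0#`, the time of the only epoch, and a tie goes to the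
  -- arrival.
  timeline-head : ∀ S → Feasible K (discreteSpace 2) zero I S →
                  ∃[ ss ] (timeline K (discreteSpace 2) zero I S ≡ arrive zero ∷ ss)
  timeline-head S feasible = merge-head _ $
    All.concat⁺ (All.map⁺ (All.map (λ 0≤t → All.map⁺ (All.universal (λ _ → 0≤t) _))
      (Feasible.nonnegative feasible)))

  ¬allBatchesBlocks : ∀ S → Feasible K (discreteSpace 2) zero I S →
                      ¬ AllBatchesBlocks K (discreteSpace 2) zero I S
  ¬allBatchesBlocks S feasible blocks
    -- Abstracting the timeline also rewrites the type of `blocks`; `run` then takes its first step,
    -- and the head of `blocks` speaks of `firstBatch`.
    with timeline K (discreteSpace 2) zero I S | timeline-head S feasible
  ... | _ | _ , refl =
    firstBatch-notBlock (All.head blocks (zero , 0∈firstBatch))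

proposition4p8 : ∀ {c ℓ₁ ℓ₂} (K : OrderedField c ℓ₁ ℓ₂) →
    ∃[ X ] ∃[ s₀ ] ∃[ I ]
    ¬ (∃[ S ] (Optimal K X s₀ I S × AllBatchesBlocks K X s₀ I S))
proposition4p8 K = discreteSpace K 2 , zero , simultaneousPair K ,
  λ (S , (feasible , _) , blocks) → ¬allBatchesBlocks K S feasible blocks
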